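{- The reduction relation $\rightsquigarrow_{\mathrm{su}'}$ is strongly terminating: there is no infinite sequence of reductions $s_0\rightsquigarrow_{\mathrm{su}'}s_1\rightsquigarrow_{\mathrm{su}'}s_2\rightsquigarrow_{\mathrm{su}'}\cdots$ of terms.
   Context: Syntax. Syntax is taken up to renaming of variables; $\equiv$ is syntactic equality, and syntax over $\Gamma$ is silently regarded as syntax over $\Gamma,(x:A)$ (weakening). By mutual induction: a context is a finite list $(x_1:A_1),\dots,(x_m:A_m)$ with $A_i$ a type over the preceding entries; a type over $\Gamma$ is $\star$ or $s\to_A t$ with $A$ a type and $s,t$ terms over $\Gamma$; a term over $\Gamma$ is a variable of $\Gamma$ or $\mathrm{Coh}_{(\Delta;A)}[\sigma]$ with $\Delta$ a context, $A$ a type over $\Delta$ and $\sigma:\Delta\to\Gamma$; a substitution $\sigma:\Delta\to\Gamma$ is a list of terms over $\Gamma$, one for each variable of $\Delta$. $x[\![\sigma]\!]$ is the entry of $\sigma$ at the variable $x$; $\mathrm{Coh}_{(\Theta;A)}[\tau][\![\sigma]\!]=\mathrm{Coh}_{(\Theta;A)}[\tau\bullet\sigma]$, where $\tau\bullet\sigma$ applies $[\![\sigma]\!]$ to each entry of $\tau$; $\star[\![\sigma]\!]=\star$; $(s\to_At)[\![\sigma]\!]=s[\![\sigma]\!]\to_{A[\![\sigma]\!]}t[\![\sigma]\!]$. $\dim\star=0$, $\dim(s\to_At)=\dim A+1$; the dimension of a context is the maximal dimension of its types. Ps-contexts. $(x:\star)\vdash_{ps}x:\star$; if $\Gamma\vdash_{ps}x:A$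 then $\Gamma,(y:A),(f:x\to_Ay)\vdash_{ps}f:x\to_Ay$; if $\Gamma\vdash_{ps}x:s\to_At$ then $\Gamma\vdash_{ps}t:A$; if $\Gamma\vdash_{ps}x:\star$ then $\Gamma\vdash_{ps}$ ($\Gamma$ is a ps-context). For $i\in\mathbb N$, $\epsilon\in\{ -,+\}$: $\partial_i^\epsilon((x:\star))=\{x\}$, and for $\Delta=\Gamma,(y:A),(f:x\to_Ay)$, $\partial^\epsilon_i(\Delta)$ is $\partial_i^\epsilon(\Gamma)$ if $i<\dim A$; $\partial_i^-(\Gamma)$ if $i=\dim A$, $\epsilon=-$; $(\partial_i^+(\Gamma)\cup\{y\})\setminus\{x\}$ if $i=\dim A$, $\epsilon=+$; $\partial_i^\epsilon(\Gamma)\cup\{y,f\}$ if $i>\dim A$. Support. $\mathrm{FV}(x)=\{x\}$, $\mathrm{FV}(\mathrm{Coh}_{(\Delta;A)}[\sigma])=\mathrm{FV}(\sigma)$, $\mathrm{FV}(\star)=\emptyset$, and $\mathrm{FV}$ of arrow types and substitutions is the union over components. $\mathrm{Supp}$ of syntax over $\Gamma$ is the smallest set $U\supseteq\mathrm{FV}$ such that $x\in U$ and $(x:A)\in\Gamma$ imply $\mathrm{FV}(A)\subseteq U$. Typing and equality. Let $\mathcal O$ be the regular operation set: all triples $(\Delta,\partial_n^-(\Delta),\partial_n^+(\Delta))$ with $\Delta$ a ps-context, $n\in\mathbb N$, $n\ge\dim\Delta-1$. An equality rule set $\mathcal R$ is a set of triples $(\Gamma,s,t)$, $s,t$ terms over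 $\Gamma$. The theory $\mathrm{Catt}_{\mathcal R}$ is generated mutually by: $\emptyset\vdash$; $\Gamma\vdash$, $\Gamma\vdash A$ give $\Gamma,(x:A)\vdash$; $\Gamma\vdash\star$; $\Gamma\vdash A$, $\Gamma\vdash s:A$, $\Gamma\vdash t:A$ give $\Gamma\vdash s\to_At$; $\Gamma\vdash\langle\rangle:\emptyset$; $\Gamma\vdash\sigma:\Delta$, $\Gamma\vdash t:A[\![\sigma]\!]$ give $\Gamma\vdash\langle\sigma,t\rangle:\Delta,(x:A)$; $(x:A)\in\Gamma$ gives $\Gamma\vdash x:A$; $\Gamma\vdash t:A$, $\Gamma\vdash A=B$ give $\Gamma\vdash t:B$; $\Delta\vdash_{ps}$, $\Delta\vdash s\to_At$, $\Gamma\vdash\sigma:\Delta$, $(\Delta,\mathrm{Supp}(s),\mathrm{Supp}(t))\in\mathcal O$ give $\Gamma\vdash\mathrm{Coh}_{(\Delta;s\to_At)}[\sigma]:(s\to_At)[\![\sigma]\!]$; equality is a congruence for all constructors (for coherences: $\Delta\vdash A=B$, $\Gamma\vdash\sigma=\tau$ give $\Gamma\vdash\mathrm{Coh}_{(\Delta;A)}[\sigma]=\mathrm{Coh}_{(\Delta;B)}[\tau]$), reflexive on variables, symmetric and transitive on terms, and $\Gamma\vdash s=t$ whenever $(\Gamma,s,t)\in\mathcal R$ and $\Gamma\vdash s:A$ for some $A$. Discs. $U^0=\star$, $U^{k+1}=d_k^-\to_{U^k}d_k^+$; $D^n$ has variables $d_0^-,d_0^+,\dots,d_{n-1}^-,d_{n-1}^+,d_n$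 with $d_k^\pm:U^k$, $d_n:U^n$. For a type $A$ over $\Gamma$ with $\dim A=n$ and a term $t$, $\{A,t\}:D^n\to\Gamma$ is the substitution with $d_n\mapsto t$ and $U^n[\![\{A,t\}]\!]\equiv A$. $\mathrm{id}(A,t)=\mathrm{Coh}_{(D^n;d_n\to_{U^n}d_n)}[\{A,t\}]$; terms of this form are called identities. Dyck words and pruning. Dyck words $W\in\mathrm{Dyck}_d$: $\ominus\in\mathrm{Dyck}_0$; $W\in\mathrm{Dyck}_d$ gives $W\Uparrow\in\mathrm{Dyck}_{d+1}$; $W\in\mathrm{Dyck}_{d+1}$ gives $W\Downarrow\in\mathrm{Dyck}_d$. Associated context, type, term: $\lfloor\ominus\rfloor=(x:\star)$, $\mathrm{Ty}_\ominus=\star$, $\mathrm{Tm}_\ominus=x$; $\lfloor W\Uparrow\rfloor=\lfloor W\rfloor,(y_W:\mathrm{Ty}_W),(f_W:\mathrm{Tm}_W\to_{\mathrm{Ty}_W}y_W)$, $\mathrm{Ty}_{W\Uparrow}=\mathrm{Tm}_W\to_{\mathrm{Ty}_W}y_W$, $\mathrm{Tm}_{W\Uparrow}=f_W$; $\lfloor W\Downarrow\rfloor=\lfloor W\rfloor$ and, if $\mathrm{Ty}_W=s\to_At$, $\mathrm{Ty}_{W\Downarrow}=A$, $\mathrm{Tm}_{W\Downarrow}=t$. A peak $p$ of $W$ is an occurrence in $W$ of $\Uparrow$ immediately followed by $\Downarrow$; if $E$ is the prefix of $W$ before it, $\lfloor p\rfloor=f_E$, and $W/\!\!/p$ is $W$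 with these two letters deleted. $\pi_p:\lfloor W\rfloor\to\lfloor W/\!\!/p\rfloor$ sends $y_E\mapsto\mathrm{Tm}_E$, $f_E\mapsto\mathrm{id}(\mathrm{Ty}_E,\mathrm{Tm}_E)$ and each other variable to the corresponding variable. For $\sigma:\lfloor W\rfloor\to\Gamma$, $\sigma/\!\!/p$ is $\sigma$ with the entries at $y_E,f_E$ deleted. Rule sets. $\mathrm{dr}$: all $(\Gamma,\mathrm{Coh}_{(D^n;U^n)}[\{A,t\}],t)$, $n=\dim A$. $\mathrm{ecr}$: all $(\Gamma,\mathrm{Coh}_{(\Delta;s\to_As)}[\sigma],\mathrm{id}(A[\![\sigma]\!],s[\![\sigma]\!]))$. $\mathrm{prune}$: all $(\Gamma,\mathrm{Coh}_{(\lfloor W\rfloor;A)}[\sigma],\mathrm{Coh}_{(\lfloor W/\!\!/p\rfloor;A[\![\pi_p]\!])}[\sigma/\!\!/p])$ with $W\in\mathrm{Dyck}_0$, $p$ a peak of $W$ and $\lfloor p\rfloor[\![\sigma]\!]$ an identity. $\mathrm{ecr}'$ and $\mathrm{prune}'$ are the subsets of $\mathrm{ecr}$ and $\mathrm{prune}$ of triples whose first term is not an identity. $\mathrm{su}'=\mathrm{dr}\cup\mathrm{prune}'\cup\mathrm{ecr}'$. Reduction. For a rule set $\mathcal R$, $\rightsquigarrow_{\mathcal R}$ is the relation on well-formed terms, types and substitutions (of $\mathrm{Catt}_{\mathcal R}$) generated by: $s\rightsquigarrow t$ if $(\Gamma,s,t)\in\mathcal R$; $\mathrm{Coh}_{(\Delta;A)}[\sigma]\rightsquigarrow\mathrm{Coh}_{(\Delta;B)}[\sigma]$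 if $A\rightsquigarrow B$; $\mathrm{Coh}_{(\Delta;A)}[\sigma]\rightsquigarrow\mathrm{Coh}_{(\Delta;A)}[\tau]$ if $\sigma\rightsquigarrow\tau$; $s\to_At$ reduces by reducing exactly one of $s,A,t$; a substitution reduces by reducing exactly one entry. -}

module Defs where

open import Data.Fin.Base using (Fin; zero; suc)
open import Data.Fin.Subset using (Subset; outside; _∈_; _∪_; _-_; ⁅_⁆; ⊥)
open import Data.Nat.Base using (ℕ; zero; suc; _⊔_; _≤_; _<_; _>_)
open import Data.Nat.Properties using (<-cmp)
open import Data.Product.Base using (Σ; ∃; ∃₂; _×_; _,_; proj₁)
open import Data.Sign.Base using (Sign)
open import Data.Sum.Base using (_⊎_)
open import Data.Vec.Base using (_∷_)
open import Level using (0ℓ)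
open import Relation.Binary.Core using (Rel)
open import Relation.Binary.Definitions using (Tri; tri<; tri≈; tri>)
open import Relation.Binary.PropositionalEquality.Core using (_≡_)
open import Relation.Nullary.Negation.Core using (¬_)
open import Relation.Unary using (Pred; _≐_)

infixl 5 _▷_ _,,_
infix  6 _⟶[_]_
infixl 8 _[_]Ty _[_]Tm _●_

-- De Bruijn indices: `zero` is the most recently added variable.  Syntax
-- over a context only depends on the number of its variables; `Sub m n` is
-- the set of substitutions from a context with m variables to one with n.

data Ctx : ℕ → Set
data Ty (n : ℕ) : Set
data Tm (n : ℕ) : Set
data Sub : ℕ → ℕ → Set

data Ctx where
  ∅   : Ctx 0
  _▷_ : ∀ {n} → Ctx n → Ty n → Ctx (suc n)

data Ty n where
  ⋆      : Ty n
  _⟶[_]_ : Tm n → Ty n → Tm n → Ty n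

data Tm n where
  Var : Fin n → Tm n
  Coh : ∀ {m} → Ctx m → Ty m → Sub m n → Tm n

data Sub where
  ⟨⟩   : ∀ {n} → Sub 0 n
  _,,_ : ∀ {m n} → Sub m n → Tm n → Sub (suc m) n

wkTy  : ∀ {n} → Ty n → Ty (suc n)
wkTm  : ∀ {n} → Tm n → Tm (suc n)
wkSub : ∀ {m n} → Sub m n → Sub m (suc n)

wkTy ⋆            = ⋆
wkTy (s ⟶[ A ] t) = wkTm s ⟶[ wkTy A ] wkTm t

wkTm (Var x)     = Var (suc x)
wkTm (Coh Δ A σ) = Coh Δ A (wkSub σ)

wkSub ⟨⟩       = ⟨⟩
wkSub (σ ,, t) = wkSub σ ,, wkTm t

idSub : ∀ {n} → Sub n n
idSub {zero}  = ⟨⟩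
idSub {suc n} = wkSub idSub ,, Var zero

lookup : ∀ {n} → Ctx n → Fin n → Ty n
lookup (Γ ▷ A) zero    = wkTy A
lookup (Γ ▷ A) (suc x) = wkTy (lookup Γ x)

entry : ∀ {m n} → Sub m n → Fin m → Tm n
entry (σ ,, t) zero    = t
entry (σ ,, t) (suc x) = entry σ x

_[_]Ty : ∀ {m n} → Ty m → Sub m n → Ty n
_[_]Tm : ∀ {m n} → Tm m → Sub m n → Tm n
_●_    : ∀ {l m n} → Sub l m → Sub m n → Sub l n

⋆            [ σ ]Ty = ⋆
(s ⟶[ A ] t) [ σ ]Ty = s [ σ ]Tm ⟶[ A [ σ ]Ty ] t [ σ ]Tm

Var x     [ σ ]Tm = entry σ x
Coh Θ A τ [ σ ]Tm = Coh Θ A (τ ● σ)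

⟨⟩       ● σ = ⟨⟩
(τ ,, t) ● σ = τ ● σ ,, t [ σ ]Tm

dim : ∀ {n} → Ty n → ℕ
dim ⋆            = 0
dim (s ⟶[ A ] t) = suc (dim A)

dimCtx : ∀ {n} → Ctx n → ℕ
dimCtx ∅       = 0
dimCtx (Γ ▷ A) = dimCtx Γ ⊔ dim A

-- The subject of the judgement is always a variable, hence a `Fin n`.

infix 4 _⊢ps_∶_ _⊢ps

data _⊢ps_∶_ : ∀ {n} → Ctx n → Fin n → Ty n → Set where
  ps-⋆ : ∅ ▷ ⋆ ⊢ps zero ∶ ⋆
  ps-⇑ : ∀ {n} {Γ : Ctx n} {x A} →
         Γ ⊢ps x ∶ A →
         Γ ▷ A ▷ (Var (suc x) ⟶[ wkTy A ] Var zero)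
           ⊢ps zero ∶ wkTy (Var (suc x) ⟶[ wkTy A ] Var zero)
  ps-⇓ : ∀ {n} {Γ : Ctx n} {x s A y} →
         Γ ⊢ps x ∶ s ⟶[ A ] Var y →
         Γ ⊢ps y ∶ A

data _⊢ps {n} (Γ : Ctx n) : Set where
  ps : ∀ {x} → Γ ⊢ps x ∶ ⋆ → Γ ⊢ps

-- `∂-extend c ε x V` is the boundary of Γ,(y : A),(f : x → y), where V is that
-- of Γ and c compares i with dim A.  In the extended context x becomes
-- `suc (suc x)`, y is `suc zero` and f is `zero`.

∂-extend : ∀ {n i k} → Tri (i < k) (i ≡ k) (i > k) → Sign →
           Fin n → Subset n → Subset (suc (suc n))
∂-extend (tri< _ _ _) _      x V = outside ∷ outside ∷ V
∂-extend (tri≈ _ _ _) Sign.- x V = outside ∷ outside ∷ V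
∂-extend (tri≈ _ _ _) Sign.+ x V =
  ((outside ∷ outside ∷ V) ∪ ⁅ suc zero ⁆) - suc (suc x)
∂-extend (tri> _ _ _) _      x V =
  (outside ∷ outside ∷ V) ∪ (⁅ suc zero ⁆ ∪ ⁅ zero ⁆)

∂ : ∀ {n} {Γ : Ctx n} {x A} → ℕ → Sign → Γ ⊢ps x ∶ A → Subset n
∂ i ε ps-⋆                     = ⁅ zero ⁆
∂ i ε (ps-⇑ {x = x} {A = A} d) = ∂-extend (<-cmp i (dim A)) ε x (∂ i ε d)
∂ i ε (ps-⇓ d)                 = ∂ i ε d

∂ps : ∀ {n} {Γ : Ctx n} → ℕ → Sign → Γ ⊢ps → Subset n
∂ps i ε (ps d) = ∂ i ε d

FVTy  : ∀ {n} → Ty n → Subset n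
FVTm  : ∀ {n} → Tm n → Subset n
FVSub : ∀ {m n} → Sub m n → Subset n

FVTy ⋆            = ⊥
FVTy (s ⟶[ A ] t) = FVTm s ∪ (FVTy A ∪ FVTm t)

FVTm (Var x)     = ⁅ x ⁆
FVTm (Coh Δ A σ) = FVSub σ

FVSub ⟨⟩       = ⊥
FVSub (σ ,, t) = FVSub σ ∪ FVTm t

-- The smallest set of variables of Γ containing U and closed under taking
-- the free variables of the types of its members.

data Closure {n} (Γ : Ctx n) (U : Subset n) : Pred (Fin n) 0ℓ where
  base : ∀ {x} → x ∈ U → Closure Γ U x
  step : ∀ {x y} → Closure Γ U x → y ∈ FVTy (lookup Γ x) → Closure Γ U y

Supp : ∀ {n} → Ctx n → Tm n → Pred (Fin n) 0ℓ
Supp Γ t = Closure Γ (FVTm t)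

-- n ≥ dim Δ - 1 is written without subtraction.

Regular : ∀ {m} → Ctx m → Rel (Pred (Fin m) 0ℓ) 0ℓ
Regular Δ U V = Σ (Δ ⊢ps) λ d → ∃ λ n →
  dimCtx Δ ≤ suc n × U ≐ (_∈ ∂ps n Sign.- d) × V ≐ (_∈ ∂ps n Sign.+ d)

RuleSet : Set₁
RuleSet = ∀ {n} → Ctx n → Rel (Tm n) 0ℓ

module Theory (R : RuleSet) where

  infix 4 _⊢Ctx _⊢Ty_ _⊢Tm_∶_ _⊢Sub_∶_ _⊢Ty_≈_ _⊢Tm_≈_ _⊢Sub_≈_

  data _⊢Ctx : ∀ {n} → Ctx n → Set
  data _⊢Ty_ {n} (Γ : Ctx n) : Ty n → Set
  data _⊢Tm_∶_ {n} (Γ : Ctx n) : Tm n → Ty n → Set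
  data _⊢Sub_∶_ {n} (Γ : Ctx n) : ∀ {m} → Sub m n → Ctx m → Set
  data _⊢Ty_≈_ {n} (Γ : Ctx n) : Rel (Ty n) 0ℓ
  data _⊢Tm_≈_ {n} (Γ : Ctx n) : Rel (Tm n) 0ℓ
  data _⊢Sub_≈_ {n} (Γ : Ctx n) : ∀ {m} → Rel (Sub m n) 0ℓ

  data _⊢Ctx where
    ⊢∅ : ∅ ⊢Ctx
    ⊢▷ : ∀ {n} {Γ : Ctx n} {A} → Γ ⊢Ctx → Γ ⊢Ty A → Γ ▷ A ⊢Ctx

  data _⊢Ty_ {n} Γ where
    ⊢⋆ : Γ ⊢Ty ⋆
    ⊢⟶ : ∀ {A s t} → Γ ⊢Ty A → Γ ⊢Tm s ∶ A → Γ ⊢Tm t ∶ A →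
         Γ ⊢Ty s ⟶[ A ] t

  data _⊢Tm_∶_ {n} Γ where
    ⊢Var  : ∀ x → Γ ⊢Tm Var x ∶ lookup Γ x
    ⊢conv : ∀ {t A B} → Γ ⊢Tm t ∶ A → Γ ⊢Ty A ≈ B → Γ ⊢Tm t ∶ B
    ⊢Coh  : ∀ {m} {Δ : Ctx m} {s A t σ} →
            Δ ⊢ps →
            Δ ⊢Ty s ⟶[ A ] t →
            Γ ⊢Sub σ ∶ Δ →
            Regular Δ (Supp Δ s) (Supp Δ t) →
            Γ ⊢Tm Coh Δ (s ⟶[ A ] t) σ ∶ (s ⟶[ A ] t) [ σ ]Ty

  data _⊢Sub_∶_ {n} Γ where
    ⊢⟨⟩ : Γ ⊢Sub ⟨⟩ ∶ ∅
    ⊢,, : ∀ {m} {Δ : Ctx m} {A σ t} →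
          Γ ⊢Sub σ ∶ Δ → Γ ⊢Tm t ∶ A [ σ ]Ty → Γ ⊢Sub σ ,, t ∶ Δ ▷ A

  data _⊢Ty_≈_ {n} Γ where
    ≈⋆ : Γ ⊢Ty ⋆ ≈ ⋆
    ≈⟶ : ∀ {s s′ A A′ t t′} →
         Γ ⊢Tm s ≈ s′ → Γ ⊢Ty A ≈ A′ → Γ ⊢Tm t ≈ t′ →
         Γ ⊢Ty s ⟶[ A ] t ≈ s′ ⟶[ A′ ] t′

  data _⊢Tm_≈_ {n} Γ where
    ≈Var   : ∀ x → Γ ⊢Tm Var x ≈ Var x
    ≈sym   : ∀ {s t} → Γ ⊢Tm s ≈ t → Γ ⊢Tm t ≈ s
    ≈trans : ∀ {s t u} → Γ ⊢Tm s ≈ t → Γ ⊢Tm t ≈ u → Γ ⊢Tm s ≈ u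
    ≈Coh   : ∀ {m} {Δ : Ctx m} {A B} {σ τ} →
             Δ ⊢Ty A ≈ B → Γ ⊢Sub σ ≈ τ → Γ ⊢Tm Coh Δ A σ ≈ Coh Δ B τ
    ≈rule  : ∀ {s t A} → R Γ s t → Γ ⊢Tm s ∶ A → Γ ⊢Tm s ≈ t

  data _⊢Sub_≈_ {n} Γ where
    ≈⟨⟩ : Γ ⊢Sub ⟨⟩ ≈ ⟨⟩
    ≈,, : ∀ {m} {σ τ : Sub m n} {s t} →
          Γ ⊢Sub σ ≈ τ → Γ ⊢Tm s ≈ t → Γ ⊢Sub σ ,, s ≈ τ ,, t

-- `Sphere n` consists of the first 2n variables of Dⁿ, over which Uⁿ is
-- already defined.

double : ℕ → ℕ
double zero    = zero
double (suc n) = suc (suc (double n))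

U : ∀ n → Ty (double n)
U zero    = ⋆
U (suc n) = Var (suc zero) ⟶[ wkTy (wkTy (U n)) ] Var zero

Sphere : ∀ n → Ctx (double n)
Sphere zero    = ∅
Sphere (suc n) = Sphere n ▷ U n ▷ wkTy (U n)

Disc : ∀ n → Ctx (suc (double n))
Disc n = Sphere n ▷ U n

-- `boundary A` is the restriction of {A,t} to the sphere: the unique
-- substitution along which U (dim A) becomes A.

boundary : ∀ {n} (A : Ty n) → Sub (double (dim A)) n
boundary ⋆            = ⟨⟩
boundary (s ⟶[ A ] t) = boundary A ,, s ,, t

⟪_,_⟫ : ∀ {n} (A : Ty n) → Tm n → Sub (suc (double (dim A))) n
⟪ A , t ⟫ = boundary A ,, t

identity : ∀ {n} → Ty n → Tm n → Tm n
identity A t =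
  Coh (Disc (dim A)) (Var zero ⟶[ wkTy (U (dim A)) ] Var zero) ⟪ A , t ⟫

IsIdentity : ∀ {n} → Tm n → Set
IsIdentity s = ∃₂ λ A t → s ≡ identity A t

data Dyck : ℕ → Set where
  ⊖  : Dyck 0
  _⇑ : ∀ {d} → Dyck d → Dyck (suc d)
  _⇓ : ∀ {d} → Dyck (suc d) → Dyck d

size : ∀ {d} → Dyck d → ℕ
size ⊖     = 1
size (W ⇑) = suc (suc (size W))
size (W ⇓) = size W

-- For W : Dyck (suc d) the type `dyckTy W` has dimension suc d, so the ⋆
-- clauses of `tyBase` and `tyTgt` are never used in `dyckTy` and `dyckTm`.

tyBase : ∀ {n} → Ty n → Ty n
tyBase ⋆            = ⋆
tyBase (s ⟶[ A ] t) = A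

tyTgt : ∀ {n} → Ty n → Tm n → Tm n
tyTgt ⋆            u = u
tyTgt (s ⟶[ A ] t) _ = t

dyckTy : ∀ {d} (W : Dyck d) → Ty (size W)
dyckTm : ∀ {d} (W : Dyck d) → Tm (size W)

dyckTy ⊖     = ⋆
dyckTy (W ⇑) = wkTy (wkTm (dyckTm W) ⟶[ wkTy (dyckTy W) ] Var zero)
dyckTy (W ⇓) = tyBase (dyckTy W)

dyckTm ⊖     = Var zero
dyckTm (W ⇑) = Var zero
dyckTm (W ⇓) = tyTgt (dyckTy W) (dyckTm W)

⌊_⌋ : ∀ {d} (W : Dyck d) → Ctx (size W)
⌊ ⊖ ⌋   = ∅ ▷ ⋆
⌊ W ⇑ ⌋ = ⌊ W ⌋ ▷ dyckTy W ▷ (wkTm (dyckTm W) ⟶[ wkTy (dyckTy W) ] Var zero)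
⌊ W ⇓ ⌋ = ⌊ W ⌋

data Peak : ∀ {d} → Dyck d → Set where
  peak : ∀ {d} (E : Dyck d) → Peak (E ⇑ ⇓)
  _⇑ᵖ  : ∀ {d} {W : Dyck d} → Peak W → Peak (W ⇑)
  _⇓ᵖ  : ∀ {d} {W : Dyck (suc d)} → Peak W → Peak (W ⇓)

_//_ : ∀ {d} (W : Dyck d) → Peak W → Dyck d
_ // peak E         = E
_ // _⇑ᵖ {W = W} p = (W // p) ⇑
_ // _⇓ᵖ {W = W} p = (W // p) ⇓

peakVar : ∀ {d} {W : Dyck d} → Peak W → Fin (size W)
peakVar (peak E) = zero
peakVar (p ⇑ᵖ)   = suc (suc (peakVar p))
peakVar (p ⇓ᵖ)   = peakVar p

π : ∀ {d} {W : Dyck d} (p : Peak W) → Sub (size W) (size (W // p))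
π (peak E) = idSub ,, dyckTm E ,, identity (dyckTy E) (dyckTm E)
π (p ⇑ᵖ)   = wkSub (wkSub (π p)) ,, Var (suc zero) ,, Var zero
π (p ⇓ᵖ)   = π p

_//Sub_ : ∀ {d} {W : Dyck d} {n} → Sub (size W) n → (p : Peak W) →
          Sub (size (W // p)) n
(σ ,, _ ,, _) //Sub peak E = σ
(σ ,, s ,, t) //Sub (p ⇑ᵖ) = (σ //Sub p) ,, s ,, t
σ             //Sub (p ⇓ᵖ) = σ //Sub p

data dr {n} (Γ : Ctx n) : Rel (Tm n) 0ℓ where
  disc-removal : ∀ A t →
    dr Γ (Coh (Disc (dim A)) (wkTy (U (dim A))) ⟪ A , t ⟫) t

data ecr {n} (Γ : Ctx n) : Rel (Tm n) 0ℓ where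
  endo-coherence-removal : ∀ {m} (Δ : Ctx m) s A (σ : Sub m n) →
    ecr Γ (Coh Δ (s ⟶[ A ] s) σ) (identity (A [ σ ]Ty) (s [ σ ]Tm))

data prune {n} (Γ : Ctx n) : Rel (Tm n) 0ℓ where
  pruning : ∀ (W : Dyck 0) (p : Peak W) A (σ : Sub (size W) n) →
    IsIdentity (Var (peakVar p) [ σ ]Tm) →
    prune Γ (Coh ⌊ W ⌋ A σ) (Coh ⌊ W // p ⌋ (A [ π p ]Ty) (σ //Sub p))

ecr′ : RuleSet
ecr′ Γ s t = ecr Γ s t × ¬ IsIdentity s

prune′ : RuleSet
prune′ Γ s t = prune Γ s t × ¬ IsIdentity s

su′ : RuleSet
su′ Γ s t = dr Γ s t ⊎ prune′ Γ s t ⊎ ecr′ Γ s t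

module Reduction (R : RuleSet) where

  open Theory R public

  infix 4 _⊢Ty_⇝_ _⊢Tm_⇝_ _⊢Sub_⇝_ _↝_

  data _⊢Ty_⇝_ {n} (Γ : Ctx n) : Rel (Ty n) 0ℓ
  data _⊢Tm_⇝_ {n} (Γ : Ctx n) : Rel (Tm n) 0ℓ
  data _⊢Sub_⇝_ {n} (Γ : Ctx n) : ∀ {m} → Rel (Sub m n) 0ℓ

  data _⊢Ty_⇝_ {n} Γ where
    ⇝src  : ∀ {s s′ A t} → Γ ⊢Tm s ⇝ s′ → Γ ⊢Ty s ⟶[ A ] t ⇝ s′ ⟶[ A ] t
    ⇝base : ∀ {s A A′ t} → Γ ⊢Ty A ⇝ A′ → Γ ⊢Ty s ⟶[ A ] t ⇝ s ⟶[ A′ ] t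
    ⇝tgt  : ∀ {s A t t′} → Γ ⊢Tm t ⇝ t′ → Γ ⊢Ty s ⟶[ A ] t ⇝ s ⟶[ A ] t′

  data _⊢Tm_⇝_ {n} Γ where
    ⇝rule : ∀ {s t} → R Γ s t → Γ ⊢Tm s ⇝ t
    ⇝cell : ∀ {m} {Δ : Ctx m} {A B σ} →
            Δ ⊢Ty A ⇝ B → Γ ⊢Tm Coh Δ A σ ⇝ Coh Δ B σ
    ⇝arg  : ∀ {m} {Δ : Ctx m} {A σ τ} →
            Γ ⊢Sub σ ⇝ τ → Γ ⊢Tm Coh Δ A σ ⇝ Coh Δ A τ

  data _⊢Sub_⇝_ {n} Γ where
    ⇝init : ∀ {m} {σ τ : Sub m n} {t} → Γ ⊢Sub σ ⇝ τ → Γ ⊢Sub σ ,, t ⇝ τ ,, t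
    ⇝last : ∀ {m} {σ : Sub m n} {s t} → Γ ⊢Tm s ⇝ t → Γ ⊢Sub σ ,, s ⇝ σ ,, t

  WfTm : ∀ {n} → Ctx n → Set
  WfTm Γ = ∃₂ λ t A → Γ ⊢Tm t ∶ A

  -- Requiring only the outermost terms to be well-formed loses nothing: by
  -- inversion of typing, all types, substitutions and terms to which the
  -- rules above are applied inside a well-formed term are well-formed.

  _↝_ : ∀ {n} {Γ : Ctx n} → Rel (WfTm Γ) 0ℓ
  _↝_ {Γ = Γ} s t = Γ ⊢Tm proj₁ s ⇝ proj₁ t

{-# OPTIONS --safe #-}
-- Weigh an identity 1 and any other coherence 2, and let `count k t` be the
-- total weight of the coherences of dimension k in t, not looking inside the
-- types carried by coherences.  Compared lexicographically, highest dimension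
-- first, these counts decrease strictly at every reduction that does not take
-- place inside the type of a coherence: disc removal and pruning delete a
-- coherence, and endo-coherence removal turns a non-identity of dimension d
-- into an identity, creating only coherences of dimension < d, because a
-- well-formed term of dimension d only counts coherences of dimension ≤ d.
-- The latter rests on dim Δ ≤ dim A for a well-formed Coh Δ A σ, which is a
-- consequence of the support condition.  Reductions inside types of coherences
-- do not increase the counts, and they terminate by induction on dimension,
-- since the terms in the type of a coherence have smaller dimension than it.
module Submission where

open import Defs
open import Data.Bool.Base using (true; false; if_then_else_)
open import Data.Empty using (⊥)
open import Data.Fin.Base using (Fin; zero; suc)
import Data.Fin.Properties as Fin
open import Data.Fin.Subset using (Subset; _∈_; _∪_; ⁅_⁆; outside)
open import Data.Fin.Subset.Properties
  using (∉⊥; x∈⁅x⁆; x∈⁅y⁆⇒x≡y; x∈p∪q⁺; x∈p∪q⁻)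
open import Data.Nat.Base
  using (ℕ; zero; suc; pred; _+_; _≤_; _<_; z≤n; s≤s; s≤s⁻¹)
open import Data.Nat.Induction using (<-wellFounded)
open import Data.Nat.Properties
open import Data.Nat.Solver using (module +-*-Solver)
open import Data.Product.Base using (Σ-syntax; ∃; _×_; _,_; proj₁; proj₂)
open import Data.Product.Relation.Binary.Lex.Strict using (×-wellFounded)
open import Data.Sign.Base using (Sign)
open import Data.Sum.Base using (_⊎_; inj₁; inj₂; [_,_]′)
open import Data.Vec.Base using (_∷_; here; there)
open import Function.Base using (id; _∘_)
open import Induction.WellFounded using (Acc; acc; WellFounded)
open import Level using (0ℓ)
open import Relation.Binary.Construct.On as On using ()
open import Relation.Binary.Core using (Rel)
open import Relation.Binary.Definitions using (DecidableEquality; tri<; tri≈; tri>)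
open import Relation.Binary.PropositionalEquality
  using (_≡_; _≢_; refl; sym; trans; cong; cong₂; subst)
open import Relation.Nullary.Decidable
  using (Dec; yes; no; does; map′; _×-dec_; dec-true; dec-false)
open import Relation.Nullary.Negation.Core using (¬_; contradiction)
open Reduction su′

-- Decidable equality of syntax

infix 4 _≟Ctx_ _≟Ty_ _≟Tm_ _≟Sub_

-- Used to decide whether a coherence is an identity, on which its weight depends.
_≟Ctx_ : ∀ {n} → DecidableEquality (Ctx n)
_≟Ty_  : ∀ {n} → DecidableEquality (Ty n)
_≟Tm_  : ∀ {n} → DecidableEquality (Tm n)
_≟Sub_ : ∀ {m n} → DecidableEquality (Sub m n)

∅       ≟Ctx ∅       = yes refl
(Γ ▷ A) ≟Ctx (Δ ▷ B) =
  map′ (λ { (refl , refl) → refl }) (λ { refl → refl , refl })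
       ((Γ ≟Ctx Δ) ×-dec (A ≟Ty B))

⋆            ≟Ty ⋆            = yes refl
⋆            ≟Ty (_ ⟶[ _ ] _) = no λ ()
(_ ⟶[ _ ] _) ≟Ty ⋆            = no λ ()
(s ⟶[ A ] t) ≟Ty (u ⟶[ B ] v) =
  map′ (λ { (refl , refl , refl) → refl }) (λ { refl → refl , refl , refl })
       ((s ≟Tm u) ×-dec (A ≟Ty B) ×-dec (t ≟Tm v))

Var x ≟Tm Var y = map′ (cong Var) (λ { refl → refl }) (x Fin.≟ y)
Var _ ≟Tm Coh _ _ _ = no λ ()
Coh _ _ _ ≟Tm Var _ = no λ ()
Coh {l} Δ A σ ≟Tm Coh {m} Θ B τ with l ≟ m
... | no l≢m   = no λ { refl → l≢m refl }
... | yes refl =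
  map′ (λ { (refl , refl , refl) → refl }) (λ { refl → refl , refl , refl })
       ((Δ ≟Ctx Θ) ×-dec (A ≟Ty B) ×-dec (σ ≟Sub τ))

⟨⟩       ≟Sub ⟨⟩       = yes refl
(σ ,, s) ≟Sub (τ ,, t) =
  map′ (λ { (refl , refl) → refl }) (λ { refl → refl , refl })
       ((σ ≟Sub τ) ×-dec (s ≟Tm t))

-- Dimensions

dim-wk : ∀ {n} (A : Ty n) → dim (wkTy A) ≡ dim A
dim-wk ⋆            = refl
dim-wk (_ ⟶[ A ] _) = cong suc (dim-wk A)

dim-wk² : ∀ {n} (A : Ty n) → dim (wkTy (wkTy A)) ≡ dim A
dim-wk² A = trans (dim-wk (wkTy A)) (dim-wk A)

dim-[] : ∀ {m n} (A : Ty m) (σ : Sub m n) → dim (A [ σ ]Ty) ≡ dim A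
dim-[] ⋆            σ = refl
dim-[] (_ ⟶[ A ] _) σ = cong suc (dim-[] A σ)

dim-U : ∀ n → dim (U n) ≡ n
dim-U zero    = refl
dim-U (suc n) = cong suc (trans (dim-wk² (U n)) (dim-U n))

dim-≈ : ∀ {n} {Γ : Ctx n} {A B} → Γ ⊢Ty A ≈ B → dim A ≡ dim B
dim-≈ ≈⋆           = refl
dim-≈ (≈⟶ _ A≈B _) = cong suc (dim-≈ A≈B)

dim-⇝ : ∀ {n} {Γ : Ctx n} {A B} → Γ ⊢Ty A ⇝ B → dim A ≡ dim B
dim-⇝ (⇝src _)    = refl
dim-⇝ (⇝base A⇝B) = cong suc (dim-⇝ A⇝B)
dim-⇝ (⇝tgt _)    = refl

dimVar : ∀ {n} → Ctx n → Fin n → ℕ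
dimVar Γ x = dim (lookup Γ x)

dimVar≤dimCtx : ∀ {n} (Γ : Ctx n) x → dimVar Γ x ≤ dimCtx Γ
dimVar≤dimCtx (Γ ▷ A) zero    rewrite dim-wk A = m≤n⊔m (dimCtx Γ) (dim A)
dimVar≤dimCtx (Γ ▷ A) (suc x) rewrite dim-wk (lookup Γ x) =
  ≤-trans (dimVar≤dimCtx Γ x) (m≤m⊔n (dimCtx Γ) (dim A))

-- Globular types

-- Records only dimensions, not typing: this already bounds the free variables of a type, and types
-- built from variables alone are irreducible.
data Globular {n} (Γ : Ctx n) : Ty n → Set where
  glob-⋆ : Globular Γ ⋆
  glob-⟶ : ∀ {x y A} → dimVar Γ x ≡ dim A → Globular Γ A → dimVar Γ y ≡ dim A →
           Globular Γ (Var x ⟶[ A ] Var y)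

glob-wk : ∀ {n} {Γ : Ctx n} {A B} → Globular Γ A → Globular (Γ ▷ B) (wkTy A)
glob-wk glob-⋆ = glob-⋆
glob-wk {Γ = Γ} (glob-⟶ {x} {y} {A} p g q) =
  glob-⟶ (trans (dim-wk (lookup Γ x)) (trans p (sym (dim-wk A))))
         (glob-wk g)
         (trans (dim-wk (lookup Γ y)) (trans q (sym (dim-wk A))))

glob-U : ∀ n → Globular (Sphere n) (U n)
glob-U zero    = glob-⋆
glob-U (suc n) =
  glob-⟶ refl (glob-wk (glob-wk (glob-U n))) refl

glob-irreducible : ∀ {n} {Γ : Ctx n} {A B} → Globular Γ A → ¬ Γ ⊢Ty A ⇝ B
glob-irreducible (glob-⟶ _ _ _) (⇝src (⇝rule (inj₁ ())))
glob-irreducible (glob-⟶ _ _ _) (⇝src (⇝rule (inj₂ (inj₁ (() , _)))))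
glob-irreducible (glob-⟶ _ _ _) (⇝src (⇝rule (inj₂ (inj₂ (() , _)))))
glob-irreducible (glob-⟶ _ g _) (⇝base A⇝B) = glob-irreducible g A⇝B
glob-irreducible (glob-⟶ _ _ _) (⇝tgt (⇝rule (inj₁ ())))
glob-irreducible (glob-⟶ _ _ _) (⇝tgt (⇝rule (inj₂ (inj₁ (() , _)))))
glob-irreducible (glob-⟶ _ _ _) (⇝tgt (⇝rule (inj₂ (inj₂ (() , _)))))

glob-FV : ∀ {n} {Γ : Ctx n} {A x} → Globular Γ A → x ∈ FVTy A → dimVar Γ x ≤ dim A
glob-FV glob-⋆ x∈ = contradiction x∈ ∉⊥
glob-FV (glob-⟶ {x} {y} {A} p g q) z∈ with x∈p∪q⁻ ⁅ x ⁆ _ z∈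
... | inj₁ z∈x rewrite x∈⁅y⁆⇒x≡y x z∈x = m≤n⇒m≤1+n (≤-reflexive p)
... | inj₂ z∈′ with x∈p∪q⁻ (FVTy A) ⁅ y ⁆ z∈′
...   | inj₁ z∈A = m≤n⇒m≤1+n (glob-FV g z∈A)
...   | inj₂ z∈y rewrite x∈⁅y⁆⇒x≡y y z∈y = m≤n⇒m≤1+n (≤-reflexive q)

ps-globular : ∀ {n} {Γ : Ctx n} {x A} → Γ ⊢ps x ∶ A →
              dimVar Γ x ≡ dim A × Globular Γ A
ps-globular ps-⋆ = refl , glob-⋆
ps-globular (ps-⇑ {Γ = Γ} {x = x} {A = A} d) with ps-globular d
... | p , g =
  refl ,
  glob-wk (glob-⟶ (trans (dim-wk (lookup Γ x)) (trans p (sym (dim-wk A))))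
                  (glob-wk g) refl)
ps-globular (ps-⇓ d) with ps-globular d
... | _ , glob-⟶ _ g q = q , g

lookup-globular : ∀ {n} {Γ : Ctx n} {x A} → Γ ⊢ps x ∶ A →
                  ∀ y → Globular Γ (lookup Γ y)
lookup-globular ps-⋆      zero          = glob-⋆
lookup-globular (ps-⇑ d)  zero          = proj₂ (ps-globular (ps-⇑ d))
lookup-globular (ps-⇑ d)  (suc zero)    = glob-wk (glob-wk (proj₂ (ps-globular d)))
lookup-globular (ps-⇑ d)  (suc (suc y)) = glob-wk (glob-wk (lookup-globular d y))
lookup-globular (ps-⇓ d)  y             = lookup-globular d y

-- Dimension of the context of a coherence

ps-dim≤ : ∀ {n} {Γ : Ctx n} {x A} → Γ ⊢ps x ∶ A → dim A ≤ dimCtx Γ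
ps-dim≤ {Γ = Γ} {x = x} d =
  subst (_≤ dimCtx Γ) (proj₁ (ps-globular d)) (dimVar≤dimCtx Γ x)

-- The witness has dimension at least the minimum of `k` and `dimCtx Γ`. Source boundaries never
-- discard a variable, so it survives an extension of the context; it is replaced by the new arrow
-- only when `k > dim A` and that arrow has top dimension.
∂⁻-dim : ∀ {n} {Γ : Ctx n} {x A} k (d : Γ ⊢ps x ∶ A) →
         ∃ λ y → y ∈ ∂ k Sign.- d × (k ≤ dimVar Γ y ⊎ dimCtx Γ ≤ dimVar Γ y)
∂⁻-dim k ps-⋆     = zero , x∈⁅x⁆ zero , inj₂ z≤n
∂⁻-dim k (ps-⇓ d) = ∂⁻-dim k d
∂⁻-dim k (ps-⇑ {Γ = Γ} {x} {A} d) with <-cmp k (dim A) | ∂⁻-dim k d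
... | tri< k<A _ _ | y , y∈ , big rewrite sym (dim-wk² (lookup Γ y)) =
  suc (suc y) , there (there y∈) ,
  inj₁ ([ id , ≤-trans (≤-trans (<⇒≤ k<A) (ps-dim≤ d)) ]′ big)
... | tri≈ _ k≡A _ | y , y∈ , big rewrite sym (dim-wk² (lookup Γ y)) =
  suc (suc y) , there (there y∈) ,
  inj₁ ([ id , ≤-trans (≤-trans (≤-reflexive k≡A) (ps-dim≤ d)) ]′ big)
... | tri> _ _ _   | y , y∈ , big =
  [ (λ k≤y → suc (suc y) , old , inj₁ (≤-trans k≤y (≤-reflexive y≡)))
  , (λ Γ≤y → [ (λ Γ≤1+A → zero , new , inj₂ (bound (≤-trans Γ≤1+A 1+A≤f) 1+A≤f))
             , (λ 1+A≤Γ → suc (suc y) , old ,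
                 inj₂ (≤-trans (bound ≤-refl 1+A≤Γ) (≤-trans Γ≤y (≤-reflexive y≡))))
             ]′ (≤-total (dimCtx Γ) (suc (dim A))))
  ]′ big
  where
  y≡ : dimVar Γ y ≡ dim (wkTy (wkTy (lookup Γ y)))
  y≡ = sym (dim-wk² (lookup Γ y))
  old : suc (suc y) ∈ (outside ∷ outside ∷ ∂ k Sign.- d) ∪ (⁅ suc zero ⁆ ∪ ⁅ zero ⁆)
  old = x∈p∪q⁺ {p = outside ∷ outside ∷ ∂ k Sign.- d} (inj₁ (there (there y∈)))
  new : zero ∈ (outside ∷ outside ∷ ∂ k Sign.- d) ∪ (⁅ suc zero ⁆ ∪ ⁅ zero ⁆)
  new = x∈p∪q⁺ {p = outside ∷ outside ∷ ∂ k Sign.- d}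
               (inj₂ (x∈p∪q⁺ {p = ⁅ suc zero ⁆} (inj₂ (x∈⁅x⁆ zero))))
  1+A≤f : suc (dim A) ≤ suc (dim (wkTy (wkTy A)))
  1+A≤f = s≤s (≤-reflexive (sym (dim-wk² A)))
  bound : ∀ {b} → dimCtx Γ ≤ b → suc (dim A) ≤ b →
          dimCtx (Γ ▷ A ▷ (Var (suc x) ⟶[ wkTy A ] Var zero)) ≤ b
  bound Γ≤b 1+A≤b =
    ⊔-lub (⊔-lub Γ≤b (≤-trans (n≤1+n _) 1+A≤b))
          (≤-trans (s≤s (≤-reflexive (dim-wk A))) 1+A≤b)

-- In a ps-context the variables in the type of `z` have dimension at most that of `z`, so closing
-- under them preserves the bound.
Supp-dim : ∀ {n} {Γ : Ctx n} {x A b} {V : Subset n} → Γ ⊢ps x ∶ A →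
           (∀ {y} → y ∈ V → dimVar Γ y ≤ b) →
           ∀ {y} → Closure Γ V y → dimVar Γ y ≤ b
Supp-dim d V≤b (base y∈V)     = V≤b y∈V
Supp-dim d V≤b (step {z} c y∈) =
  ≤-trans (glob-FV (lookup-globular d z) y∈) (Supp-dim d V≤b c)

regular-dim : ∀ {m} {Δ : Ctx m} s t {b} →
              (∀ {y} → y ∈ FVTm s → dimVar Δ y ≤ b) →
              Regular Δ (Supp Δ s) (Supp Δ t) → dimCtx Δ ≤ suc b
regular-dim s t s≤b (ps d , k , Δ≤1+k , (_ , ∂⁻⊆s) , _) with ∂⁻-dim k d
-- The support of `s` is the source boundary, so `y` lies in it and has dimension at most `b`;
-- together with `dimCtx Δ ≤ suc k` this bounds `Δ`.
... | y , y∈ , big =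
  [ (λ k≤y → ≤-trans Δ≤1+k (s≤s (≤-trans k≤y y≤b)))
  , (λ Δ≤y → m≤n⇒m≤1+n (≤-trans Δ≤y y≤b))
  ]′ big
  where y≤b = Supp-dim d s≤b (∂⁻⊆s y∈)

-- Mutual induction on typing: the free variables of `s` have dimension at most `dim A`, so the
-- support condition bounds the context of a coherence, which in turn bounds the free variables of
-- its arguments.
coh-dim   : ∀ {m} {Δ : Ctx m} {s A t} → Δ ⊢Ty s ⟶[ A ] t →
            Regular Δ (Supp Δ s) (Supp Δ t) → dimCtx Δ ≤ suc (dim A)
FVTm-dim  : ∀ {n} {Γ : Ctx n} {t A x} → Γ ⊢Tm t ∶ A →
            x ∈ FVTm t → dimVar Γ x ≤ dim A
FVSub-dim : ∀ {m n} {Γ : Ctx n} {Δ : Ctx m} {σ x} → Γ ⊢Sub σ ∶ Δ →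
            x ∈ FVSub σ → dimVar Γ x ≤ dimCtx Δ

coh-dim {s = s} {t = t} (⊢⟶ _ ⊢s _) reg = regular-dim s t (FVTm-dim ⊢s) reg

FVTm-dim (⊢Var y) x∈ rewrite x∈⁅y⁆⇒x≡y y x∈ = ≤-refl
FVTm-dim (⊢conv ⊢t A≈B) x∈ = subst (_ ≤_) (dim-≈ A≈B) (FVTm-dim ⊢t x∈)
FVTm-dim (⊢Coh {A = A} {σ = σ} _ ⊢A ⊢σ reg) x∈ rewrite dim-[] A σ =
  ≤-trans (FVSub-dim ⊢σ x∈) (coh-dim ⊢A reg)

FVSub-dim ⊢⟨⟩ x∈ = contradiction x∈ ∉⊥
FVSub-dim {Γ = Γ} (⊢,, {Δ = Δ} {A = A} {σ} {t} ⊢σ ⊢t) x∈ with x∈p∪q⁻ (FVSub σ) (FVTm t) x∈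
... | inj₁ x∈σ = ≤-trans (FVSub-dim ⊢σ x∈σ) (m≤m⊔n (dimCtx Δ) (dim A))
... | inj₂ x∈t = ≤-trans (FVTm-dim ⊢t x∈t)
  (≤-trans (≤-reflexive (dim-[] A σ)) (m≤n⊔m (dimCtx Δ) (dim A)))

-- Counting coherences

data IdCell (n : ℕ) : ∀ {m} → Ctx m → Ty m → Set where
  id-cell : IdCell n (Disc n) (Var zero ⟶[ wkTy (U n) ] Var zero)

idCell? : ∀ n {m} (Δ : Ctx m) A → Dec (IdCell n Δ A)
idCell? n {m} Δ A with m ≟ suc (double n)
... | no m≢    = no λ { id-cell → m≢ refl }
... | yes refl =
  map′ (λ { (refl , refl) → id-cell }) (λ { id-cell → refl , refl })
       ((Δ ≟Ctx Disc n) ×-dec (A ≟Ty (Var zero ⟶[ wkTy (U n) ] Var zero)))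

-- The cell of an identity over `Disc n` has dimension `n + 1`, hence `pred`; at `⋆` the default 0
-- is harmless, as `⋆` is no arrow. Arguments are ignored: they do not affect being an identity, by
-- `idCell⇒identity`.
weight : ∀ {m} → Ctx m → Ty m → ℕ
weight Δ A = if does (idCell? (pred (dim A)) Δ A) then 1 else 2

atDim : ℕ → ℕ → ℕ → ℕ
atDim k d w = if does (k ≟ d) then w else 0

count    : ℕ → ∀ {n} → Tm n → ℕ
countSub : ℕ → ∀ {m n} → Sub m n → ℕ

count k (Var _)     = 0
count k (Coh Δ A σ) = atDim k (dim A) (weight Δ A) + countSub k σ

countSub k ⟨⟩       = 0
countSub k (σ ,, t) = countSub k σ + count k t

atDim-≡ : ∀ d w → atDim d d w ≡ w
atDim-≡ d w rewrite dec-true (d ≟ d) refl = refl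

atDim-≢ : ∀ {k d} w → k ≢ d → atDim k d w ≡ 0
atDim-≢ {k} {d} w k≢d rewrite dec-false (k ≟ d) k≢d = refl

atDim-mono : ∀ k d {v w} → v ≤ w → atDim k d v ≤ atDim k d w
atDim-mono k d v≤w with does (k ≟ d)
... | true  = v≤w
... | false = z≤n

1≤weight : ∀ {m} (Δ : Ctx m) A → 1 ≤ weight Δ A
1≤weight Δ A with does (idCell? (pred (dim A)) Δ A)
... | true  = s≤s z≤n
... | false = s≤s z≤n

weight≤2 : ∀ {m} (Δ : Ctx m) A → weight Δ A ≤ 2
weight≤2 Δ A with does (idCell? (pred (dim A)) Δ A)
... | true  = s≤s z≤n
... | false = s≤s (s≤s z≤n)

-- A sphere classifies types. The equality is one of pairs because the lengths `double n` and
-- `double (dim A)` agree only once `n` is identified with `dim A`.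
as-boundary : ∀ n {l} (σ : Sub (double n) l) →
              Σ[ A ∈ Ty l ] _≡_ {A = Σ[ k ∈ ℕ ] Sub (double k) l}
                                (n , σ) (dim A , boundary A)
as-boundary zero    ⟨⟩ = ⋆ , refl
as-boundary (suc n) (σ ,, s ,, t) with as-boundary n σ
... | A , refl = s ⟶[ A ] t , refl

idCell⇒identity : ∀ {n m l} {Δ : Ctx m} {A} (σ : Sub m l) →
                  IdCell n Δ A → IsIdentity (Coh Δ A σ)
idCell⇒identity {n} (σ ,, t) id-cell with as-boundary n σ
... | A , refl = A , t , refl

weight-nonidentity : ∀ {m l} {Δ : Ctx m} {A} {σ : Sub m l} →
                     ¬ IsIdentity (Coh Δ A σ) → weight Δ A ≡ 2
weight-nonidentity {Δ = Δ} {A} {σ} ¬id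
  rewrite dec-false (idCell? (pred (dim A)) Δ A) (¬id ∘ idCell⇒identity σ) = refl

-- A non-identity cell already has the maximal weight 2, and an identity cell consists of variables,
-- so it cannot reduce.
weight-⇝ : ∀ {m} {Δ : Ctx m} {A B} → Δ ⊢Ty A ⇝ B → weight Δ B ≤ weight Δ A
weight-⇝ {Δ = Δ} {A} {B} A⇝B with idCell? (pred (dim A)) Δ A
... | no  _ = weight≤2 Δ B
... | yes c = contradiction A⇝B (irreducible c)
  where
  irreducible : ∀ {n m} {Δ : Ctx m} {A B} → IdCell n Δ A → ¬ Δ ⊢Ty A ⇝ B
  irreducible {n} id-cell =
    glob-irreducible (glob-⟶ refl (glob-wk {Γ = Sphere n} (glob-U n)) refl)

count-identity : ∀ k {n} (A : Ty n) t →
  count k (identity A t) ≡ atDim k (suc (dim A)) 1 + countSub k ⟪ A , t ⟫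
count-identity k A t rewrite dim-wk (U (dim A)) | dim-U (dim A)
  | dec-true (idCell? (dim A) (Disc (dim A)) (Var zero ⟶[ wkTy (U (dim A)) ] Var zero)) id-cell
  = refl

-- Well-formed terms only count coherences of dimension at most their own

inv-Coh : ∀ {m n} {Γ : Ctx n} {Δ : Ctx m} {A σ B} → Γ ⊢Tm Coh Δ A σ ∶ B →
          Δ ⊢Ty A × Γ ⊢Sub σ ∶ Δ
inv-Coh (⊢conv ⊢t _)     = inv-Coh ⊢t
inv-Coh (⊢Coh _ ⊢A ⊢σ _) = ⊢A , ⊢σ

count-vanishes    : ∀ {n} {Γ : Ctx n} {t A k} → Γ ⊢Tm t ∶ A →
                    dim A < k → count k t ≡ 0
countSub-vanishes : ∀ {m n} {Γ : Ctx n} {Δ : Ctx m} {σ k} → Γ ⊢Sub σ ∶ Δ →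
                    dimCtx Δ < k → countSub k σ ≡ 0

count-vanishes (⊢Var x) A<k = refl
count-vanishes (⊢conv ⊢t A≈B) B<k =
  count-vanishes ⊢t (≤-<-trans (≤-reflexive (dim-≈ A≈B)) B<k)
count-vanishes (⊢Coh {A = A} {σ = σ} _ ⊢A ⊢σ reg) A<k rewrite dim-[] A σ =
  cong₂ _+_ (atDim-≢ _ (>⇒≢ A<k))
            (countSub-vanishes ⊢σ (≤-<-trans (coh-dim ⊢A reg) A<k))

countSub-vanishes ⊢⟨⟩ Δ<k = refl
countSub-vanishes (⊢,, {Δ = Δ} {A = A} {σ} ⊢σ ⊢t) Δ<k =
  cong₂ _+_ (countSub-vanishes ⊢σ (≤-<-trans (m≤m⊔n (dimCtx Δ) (dim A)) Δ<k))
            (count-vanishes ⊢t (≤-<-trans (≤-trans (≤-reflexive (dim-[] A σ))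
                                                   (m≤n⊔m (dimCtx Δ) (dim A))) Δ<k))

entry-vanishes : ∀ {m n} {Γ : Ctx n} {Δ : Ctx m} {σ k} → Γ ⊢Sub σ ∶ Δ →
                 ∀ x → dimVar Δ x < k → count k (entry σ x) ≡ 0
entry-vanishes (⊢,, {A = A} {σ} ⊢σ ⊢t) zero A<k rewrite dim-wk A =
  count-vanishes ⊢t (≤-<-trans (≤-reflexive (dim-[] A σ)) A<k)
entry-vanishes (⊢,, {Δ = Δ} ⊢σ _) (suc x) x<k rewrite dim-wk (lookup Δ x) =
  entry-vanishes ⊢σ x x<k

-- Induction on the typing of `t` bounds `t [ σ ]Tm` directly, without first showing that
-- substitution preserves typing.
count-[]-vanishes : ∀ {m n} {Γ : Ctx n} {Δ : Ctx m} {t A σ k} →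
  Δ ⊢Tm t ∶ A → Γ ⊢Sub σ ∶ Δ → dim A < k → count k (t [ σ ]Tm) ≡ 0
countSub-●-vanishes : ∀ {l m n} {Γ : Ctx n} {Δ : Ctx m} {Θ : Ctx l} {τ σ k} →
  Δ ⊢Sub τ ∶ Θ → Γ ⊢Sub σ ∶ Δ → dimCtx Θ < k → countSub k (τ ● σ) ≡ 0

count-[]-vanishes (⊢Var x) ⊢σ A<k = entry-vanishes ⊢σ x A<k
count-[]-vanishes (⊢conv ⊢t A≈B) ⊢σ B<k =
  count-[]-vanishes ⊢t ⊢σ (≤-<-trans (≤-reflexive (dim-≈ A≈B)) B<k)
count-[]-vanishes (⊢Coh {A = A} {σ = τ} _ ⊢A ⊢τ reg) ⊢σ A<k rewrite dim-[] A τ =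
  cong₂ _+_ (atDim-≢ _ (>⇒≢ A<k))
            (countSub-●-vanishes ⊢τ ⊢σ (≤-<-trans (coh-dim ⊢A reg) A<k))

countSub-●-vanishes ⊢⟨⟩ ⊢σ Θ<k = refl
countSub-●-vanishes (⊢,, {Δ = Θ} {A = A} {τ} ⊢τ ⊢t) ⊢σ Θ<k =
  cong₂ _+_ (countSub-●-vanishes ⊢τ ⊢σ (≤-<-trans (m≤m⊔n (dimCtx Θ) (dim A)) Θ<k))
            (count-[]-vanishes ⊢t ⊢σ (≤-<-trans (≤-trans (≤-reflexive (dim-[] A τ))
                                                         (m≤n⊔m (dimCtx Θ) (dim A))) Θ<k))

boundary-[]-vanishes : ∀ {m n} {Γ : Ctx n} {Δ : Ctx m} {A σ k} →
  Δ ⊢Ty A → Γ ⊢Sub σ ∶ Δ → dim A ≤ k → countSub k (boundary (A [ σ ]Ty)) ≡ 0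
boundary-[]-vanishes ⊢⋆ ⊢σ _ = refl
boundary-[]-vanishes (⊢⟶ ⊢A ⊢s ⊢t) ⊢σ A<k =
  cong₂ _+_ (cong₂ _+_ (boundary-[]-vanishes ⊢A ⊢σ (<⇒≤ A<k)) (count-[]-vanishes ⊢s ⊢σ A<k))
            (count-[]-vanishes ⊢t ⊢σ A<k)

-- The lexicographic order on counts

infix 4 _≼_ _≺_

_≼_ : Rel (ℕ → ℕ) 0ℓ
f ≼ g = ∀ k → f k ≤ g k

-- Values below `k` may grow arbitrarily. The relation is not well-founded on all functions;
-- functions that vanish from some `N` on are accessible, hence `Below`.
_≺_ : Rel (ℕ → ℕ) 0ℓ
f ≺ g = ∃ λ k → f k < g k × (∀ j → k < j → f j ≤ g j)

≺-≼-trans : ∀ {f g h} → f ≺ g → g ≼ h → f ≺ h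
≺-≼-trans (k , f<g , f≤g) g≤h =
  k , <-≤-trans f<g (g≤h k) , λ j k<j → ≤-trans (f≤g j k<j) (g≤h j)

+-monoʳ-≺ : ∀ (h : ℕ → ℕ) {f g} → f ≺ g → (λ k → h k + f k) ≺ (λ k → h k + g k)
+-monoʳ-≺ h (k , f<g , f≤g) =
  k , +-monoʳ-< (h k) f<g , λ j k<j → +-monoʳ-≤ (h j) (f≤g j k<j)

+-monoˡ-≺ : ∀ (h : ℕ → ℕ) {f g} → f ≺ g → (λ k → f k + h k) ≺ (λ k → g k + h k)
+-monoˡ-≺ h (k , f<g , f≤g) =
  k , +-monoˡ-< (h k) f<g , λ j k<j → +-monoˡ-≤ (h j) (f≤g j k<j)

Below : ℕ → (ℕ → ℕ) → Set
Below N f = ∀ k → N ≤ k → f k ≡ 0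

≺-Below : ∀ {N f g} → Below N g → ((k , _) : f ≺ g) → k < N
≺-Below {N} g↓ (k , f<g , _) with <-≤-connex k N
... | inj₁ k<N = k<N
... | inj₂ N≤k = contradiction (<-≤-trans f<g (≤-reflexive (g↓ k N≤k))) n≮0

Below-≺ : ∀ {N f g} → Below N g → f ≺ g → Below N f
Below-≺ g↓ f≺g@(k , _ , f≤g) j N≤j =
  n≤0⇒n≡0 (≤-trans (f≤g j (<-≤-trans (≺-Below g↓ f≺g) N≤j)) (≤-reflexive (g↓ j N≤j)))

Lex : ℕ → Rel (ℕ → ℕ) 0ℓ
Lex zero    _ _ = ⊥
Lex (suc N) f g = f N < g N ⊎ (f N ≡ g N × Lex N f g)

Lex-wellFounded : ∀ N → WellFounded (Lex N)
Lex-wellFounded zero    f = acc λ ()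
Lex-wellFounded (suc N) =
  On.wellFounded (λ f → f N , f) (×-wellFounded <-wellFounded (Lex-wellFounded N))

-- Descending from the top, each position above `k` either decreases already or is equal and can be
-- skipped.
≺⇒Lex : ∀ {N f g} (f≺g : f ≺ g) → proj₁ f≺g < N → Lex N f g
≺⇒Lex {suc N} (k , f<g , f≤g) k<1+N with m<1+n⇒m<n∨m≡n k<1+N
... | inj₂ refl = inj₁ f<g
... | inj₁ k<N with m≤n⇒m<n∨m≡n (f≤g N k<N)
...   | inj₁ fN<gN = inj₁ fN<gN
...   | inj₂ fN≡gN = inj₂ (fN≡gN , ≺⇒Lex (k , f<g , f≤g) k<N)

≺-acc : ∀ {N f} → Below N f → Acc _≺_ f
≺-acc {N} = go (Lex-wellFounded N _)
  where
  go : ∀ {f} → Acc (Lex N) f → Below N f → Acc _≺_ f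
  go (acc rs) f↓ =
    acc λ g≺f → go (rs (≺⇒Lex g≺f (≺-Below f↓ g≺f))) (Below-≺ f↓ g≺f)

-- The effect of reductions on counts

-- Reductions inside the type of some coherence: the ones that may leave all counts unchanged.
data CellStepTm {n} : Rel (Tm n) 0ℓ
data CellStepSub {n} : ∀ {m} → Rel (Sub m n) 0ℓ

data CellStepTm {n} where
  cell : ∀ {m} {Δ : Ctx m} {A B} {σ : Sub m n} → Δ ⊢Ty A ⇝ B →
         CellStepTm (Coh Δ A σ) (Coh Δ B σ)
  arg  : ∀ {m} {Δ : Ctx m} {A} {σ τ : Sub m n} → CellStepSub σ τ →
         CellStepTm (Coh Δ A σ) (Coh Δ A τ)

data CellStepSub {n} where
  init : ∀ {m} {σ τ : Sub m n} {t} → CellStepSub σ τ → CellStepSub (σ ,, t) (τ ,, t)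
  last : ∀ {m} {σ : Sub m n} {s t} → CellStepTm s t → CellStepSub (σ ,, s) (σ ,, t)

counts : ∀ {n} → Tm n → ℕ → ℕ
counts t k = count k t

countsSub : ∀ {m n} → Sub m n → ℕ → ℕ
countsSub σ k = countSub k σ

dr-decreases : ∀ {n} {Γ : Ctx n} {s t} → dr Γ s t → counts t ≺ counts s
-- The drop occurs at the dimension of the removed disc coherence.
dr-decreases (disc-removal A t) = k , strict , λ j _ → weak j
  where
  D = Disc (dim A)
  V = wkTy (U (dim A))
  k = dim V
  weak : ∀ j → count j t ≤ atDim j k (weight D V) + (countSub j (boundary A) + count j t)
  weak j = ≤-trans (m≤n+m _ (countSub j (boundary A))) (m≤n+m _ (atDim j k (weight D V)))
  strict : count k t < atDim k k (weight D V) + (countSub k (boundary A) + count k t)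
  strict rewrite atDim-≡ k (weight D V) =
    +-mono-≤ (1≤weight D V) (m≤n+m _ (countSub k (boundary A)))

count-// : ∀ {d n} {W : Dyck d} (σ : Sub (size W) n) (p : Peak W) k →
           countSub k (σ //Sub p) + count k (entry σ (peakVar p)) ≤ countSub k σ
count-// (σ ,, s ,, t) (peak E) k = +-monoˡ-≤ (count k t) (m≤m+n (countSub k σ) (count k s))
count-// (σ ,, s ,, t) (p ⇑ᵖ)   k = begin
  (a + b + c) + d ≡⟨ solve 4 (λ a b c d → (a :+ b :+ c) :+ d := (a :+ d) :+ b :+ c) refl a b c d ⟩
  (a + d) + b + c ≤⟨ +-monoˡ-≤ c (+-monoˡ-≤ b (count-// σ p k)) ⟩
  countSub k σ + b + c ∎
  where
  open ≤-Reasoning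
  open +-*-Solver
  a = countSub k (σ //Sub p)
  b = count k s
  c = count k t
  d = count k (entry σ (peakVar p))
count-// σ (p ⇓ᵖ) k = count-// σ p k

prune-decreases : ∀ {n} {Γ : Ctx n} {s t} → prune′ Γ s t → counts t ≺ counts s
prune-decreases (pruning W p A σ (B , u , σp≡id) , ¬id) =
  -- The deleted entry is `identity B u`, which counts at `suc (dim B)`. The new head has the same
  -- dimension as the old one, whose weight is already the maximal 2.
  suc (dim B) , +-mono-≤-< (cell≤ (suc (dim B))) σ< , λ j _ → +-mono-≤ (cell≤ j) (σ≤ j)
  where
  cell≤ : ∀ j → atDim j (dim (A [ π p ]Ty)) (weight ⌊ W // p ⌋ (A [ π p ]Ty)) ≤
                atDim j (dim A) (weight ⌊ W ⌋ A)
  cell≤ j =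
    subst (λ d → atDim j d (weight ⌊ W // p ⌋ (A [ π p ]Ty)) ≤ atDim j (dim A) (weight ⌊ W ⌋ A))
          (sym (dim-[] A (π p)))
          (atDim-mono j (dim A) (≤-trans (weight≤2 ⌊ W // p ⌋ (A [ π p ]Ty))
                                         (≤-reflexive (sym (weight-nonidentity ¬id)))))
  σ≤ : ∀ j → countSub j (σ //Sub p) ≤ countSub j σ
  σ≤ j = ≤-trans (m≤m+n _ _) (count-// σ p j)
  id-counted : 0 < count (suc (dim B)) (entry σ (peakVar p))
  id-counted rewrite σp≡id | count-identity (suc (dim B)) B u | atDim-≡ (suc (dim B)) 1 =
    s≤s z≤n
  σ< : countSub (suc (dim B)) (σ //Sub p) < countSub (suc (dim B)) σ
  σ< = <-≤-trans (m<m+n _ id-counted) (count-// σ p _)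

ecr-decreases : ∀ {n} {Γ : Ctx n} {s t A} → Γ ⊢Tm s ∶ A → ecr′ Γ s t →
                counts t ≺ counts s
ecr-decreases ⊢t (endo-coherence-removal Δ s A σ , ¬id) with inv-Coh ⊢t
... | ⊢⟶ ⊢A ⊢s _ , ⊢σ = suc (dim A) , strict , above
  where
  -- Above `dim A` only the head of the new identity counts.
  target : ∀ k → dim A < k →
           count k (identity (A [ σ ]Ty) (s [ σ ]Tm)) ≡ atDim k (suc (dim A)) 1
  target k A<k =
    trans (count-identity k (A [ σ ]Ty) (s [ σ ]Tm))
    (trans (cong₂ _+_ (cong (λ d → atDim k (suc d) 1) (dim-[] A σ))
                      (cong₂ _+_ (boundary-[]-vanishes ⊢A ⊢σ (<⇒≤ A<k))
                                 (count-[]-vanishes ⊢s ⊢σ A<k)))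
           (+-identityʳ _))
  source : count (suc (dim A)) (Coh Δ (s ⟶[ A ] s) σ) ≡ 2 + countSub (suc (dim A)) σ
  source = cong (_+ countSub (suc (dim A)) σ)
                (trans (atDim-≡ (suc (dim A)) _) (weight-nonidentity ¬id))
  strict : count (suc (dim A)) (identity (A [ σ ]Ty) (s [ σ ]Tm)) <
           count (suc (dim A)) (Coh Δ (s ⟶[ A ] s) σ)
  strict = begin-strict
    count (suc (dim A)) (identity (A [ σ ]Ty) (s [ σ ]Tm)) ≡⟨ target _ (n<1+n (dim A)) ⟩
    atDim (suc (dim A)) (suc (dim A)) 1        ≡⟨ atDim-≡ (suc (dim A)) 1 ⟩
    1                                          <⟨ s≤s (s≤s z≤n) ⟩
    2 + countSub (suc (dim A)) σ               ≡⟨ source ⟨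
    count (suc (dim A)) (Coh Δ (s ⟶[ A ] s) σ) ∎
    where open ≤-Reasoning
  above : ∀ j → suc (dim A) < j →
          count j (identity (A [ σ ]Ty) (s [ σ ]Tm)) ≤ count j (Coh Δ (s ⟶[ A ] s) σ)
  above j A<j =
    ≤-trans (≤-reflexive (trans (target j (<⇒≤ A<j)) (atDim-≢ 1 (>⇒≢ A<j)))) z≤n

⇝Tm-counts  : ∀ {n} {Γ : Ctx n} {s t A} → Γ ⊢Tm s ∶ A → Γ ⊢Tm s ⇝ t →
              counts t ≺ counts s ⊎ (CellStepTm s t × counts t ≼ counts s)
⇝Sub-counts : ∀ {m n} {Γ : Ctx n} {Δ : Ctx m} {σ τ} → Γ ⊢Sub σ ∶ Δ → Γ ⊢Sub σ ⇝ τ →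
              countsSub τ ≺ countsSub σ ⊎ (CellStepSub σ τ × countsSub τ ≼ countsSub σ)

⇝Tm-counts ⊢s (⇝rule (inj₁ r))        = inj₁ (dr-decreases r)
⇝Tm-counts ⊢s (⇝rule (inj₂ (inj₁ r))) = inj₁ (prune-decreases r)
⇝Tm-counts ⊢s (⇝rule (inj₂ (inj₂ r))) = inj₁ (ecr-decreases ⊢s r)
⇝Tm-counts ⊢s (⇝cell {Δ = Δ} {A} {B} {σ} A⇝B) = inj₂ (cell A⇝B , smaller)
  where
  smaller : counts (Coh Δ B σ) ≼ counts (Coh Δ A σ)
  smaller k = +-monoˡ-≤ (countSub k σ)
    (subst (λ d → atDim k (dim B) (weight Δ B) ≤ atDim k d (weight Δ A))
           (sym (dim-⇝ A⇝B)) (atDim-mono k (dim B) (weight-⇝ A⇝B)))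
⇝Tm-counts ⊢s (⇝arg {Δ = Δ} {A} σ⇝τ) with ⇝Sub-counts (proj₂ (inv-Coh ⊢s)) σ⇝τ
... | inj₁ τ≺σ       = inj₁ (+-monoʳ-≺ (λ k → atDim k (dim A) (weight Δ A)) τ≺σ)
... | inj₂ (c , τ≼σ) = inj₂ (arg c , λ k → +-monoʳ-≤ (atDim k (dim A) (weight Δ A)) (τ≼σ k))

⇝Sub-counts (⊢,, ⊢σ _) (⇝init {t = t} σ⇝τ) with ⇝Sub-counts ⊢σ σ⇝τ
... | inj₁ τ≺σ       = inj₁ (+-monoˡ-≺ (counts t) τ≺σ)
... | inj₂ (c , τ≼σ) = inj₂ (init c , λ k → +-monoˡ-≤ (count k t) (τ≼σ k))
⇝Sub-counts (⊢,, _ ⊢s) (⇝last {σ = σ} s⇝t) with ⇝Tm-counts ⊢s s⇝t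
... | inj₁ t≺s       = inj₁ (+-monoʳ-≺ (countsSub σ) t≺s)
... | inj₂ (c , t≼s) = inj₂ (last c , λ k → +-monoʳ-≤ (countSub k σ) (t≼s k))

-- Strong normalisation

-- Accessibility only quantifies over well-formed reducts, which spares us
-- subject reduction.

WellFormed : ∀ {n} → Ctx n → Tm n → Set
WellFormed Γ t = ∃ λ A → Γ ⊢Tm t ∶ A

SNTm : ∀ {n} → Ctx n → Tm n → Set
SNTm Γ = Acc (λ u t → WellFormed Γ u × Γ ⊢Tm t ⇝ u)

SNTy : ∀ {n} → Ctx n → Ty n → Set
SNTy Γ = Acc (λ B A → (Γ ⊢Ty B) × (Γ ⊢Ty A ⇝ B))

CellSNTm : ∀ {n} → Ctx n → Tm n → Set
CellSNTm Γ = Acc (λ u t → WellFormed Γ u × CellStepTm t u)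

CellSNSub : ∀ {m n} → Ctx n → Ctx m → Sub m n → Set
CellSNSub Γ Δ = Acc (λ τ σ → Γ ⊢Sub τ ∶ Δ × CellStepSub σ τ)

-- Each reduction advances exactly one of the three accessibility proofs; inverting the typing of
-- the reduct shows that the reduced component is well-formed.
SNTy-⟶ : ∀ {n} {Γ : Ctx n} {s A t} →
         SNTm Γ s → SNTy Γ A → SNTm Γ t → SNTy Γ (s ⟶[ A ] t)
SNTy-⟶ p@(acc p′) q@(acc q′) r@(acc r′) = acc λ
  { (⊢⟶ _ ⊢s _ , ⇝src s⇝)  → SNTy-⟶ (p′ ((_ , ⊢s) , s⇝)) q r
  ; (⊢⟶ ⊢A _ _ , ⇝base A⇝) → SNTy-⟶ p (q′ (⊢A , A⇝)) r
  ; (⊢⟶ _ _ ⊢t , ⇝tgt t⇝)  → SNTy-⟶ p q (r′ ((_ , ⊢t) , t⇝))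
  }

CellSN-Coh : ∀ {m n} {Γ : Ctx n} {Δ : Ctx m} {A σ} →
             SNTy Δ A → CellSNSub Γ Δ σ → CellSNTm Γ (Coh Δ A σ)
CellSN-Coh p@(acc p′) q@(acc q′) = acc λ
  { ((_ , ⊢u) , cell A⇝) → CellSN-Coh (p′ (proj₁ (inv-Coh ⊢u) , A⇝)) q
  ; ((_ , ⊢u) , arg σ⇝)  → CellSN-Coh p (q′ (proj₂ (inv-Coh ⊢u) , σ⇝))
  }

CellSN-,, : ∀ {m n} {Γ : Ctx n} {Δ : Ctx m} {A σ t} →
            CellSNSub Γ Δ σ → CellSNTm Γ t → CellSNSub Γ (Δ ▷ A) (σ ,, t)
CellSN-,, p@(acc p′) q@(acc q′) = acc λ
  { (⊢,, ⊢σ _ , init σ⇝) → CellSN-,, (p′ (⊢σ , σ⇝)) q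
  ; (⊢,, _ ⊢t , last t⇝) → CellSN-,, p (q′ ((_ , ⊢t) , t⇝))
  }

CellsSN : ℕ → Set
CellsSN N = ∀ {m} {Δ : Ctx m} {A} → Δ ⊢Ty A → dim A < N → SNTy Δ A

-- A coherence of dimension `d` counts at least 1 at `d`, so `Below N` forces `d < N` and `sn`
-- applies to its type. Cell steps act independently on the different coherences.
cellSNTm  : ∀ {N n} {Γ : Ctx n} {t A} → CellsSN N → Γ ⊢Tm t ∶ A →
            Below N (counts t) → CellSNTm Γ t
cellSNSub : ∀ {N m n} {Γ : Ctx n} {Δ : Ctx m} {σ} → CellsSN N → Γ ⊢Sub σ ∶ Δ →
            Below N (countsSub σ) → CellSNSub Γ Δ σ

cellSNTm sn (⊢Var x)      t↓ = acc λ { (_ , ()) }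
cellSNTm sn (⊢conv ⊢t _)  t↓ = cellSNTm sn ⊢t t↓
cellSNTm {N} sn (⊢Coh {Δ = Δ} {s} {A} {t} {σ} _ ⊢A ⊢σ _) t↓ =
  CellSN-Coh (sn ⊢A small)
             (cellSNSub sn ⊢σ λ k N≤k →
               m+n≡0⇒n≡0 (atDim k (suc (dim A)) (weight Δ (s ⟶[ A ] t))) (t↓ k N≤k))
  where
  d = suc (dim A)
  w = weight Δ (s ⟶[ A ] t)
  small : d < N
  small with <-≤-connex d N
  ... | inj₁ d<N = d<N
  ... | inj₂ N≤d = contradiction
    (subst (1 ≤_) (trans (sym (atDim-≡ d w)) (m+n≡0⇒m≡0 (atDim d d w) (t↓ d N≤d)))
           (1≤weight Δ (s ⟶[ A ] t)))
    n≮0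

cellSNSub sn ⊢⟨⟩ σ↓ = acc λ { (_ , ()) }
cellSNSub sn (⊢,, {σ = σ} ⊢σ ⊢t) σ↓ =
  CellSN-,, (cellSNSub sn ⊢σ λ k N≤k → m+n≡0⇒m≡0 (countSub k σ) (σ↓ k N≤k))
            (cellSNTm sn ⊢t λ k N≤k → m+n≡0⇒n≡0 (countSub k σ) (σ↓ k N≤k))

-- Outer induction on a bound for the counts, inner induction on cell steps.
cells⇒SNTm : ∀ {N n} {Γ : Ctx n} {t} → CellsSN N → WellFormed Γ t →
             Below N (counts t) → SNTm Γ t
cells⇒SNTm {N} {Γ = Γ} sn (_ , ⊢t) t↓ =
  go (≺-acc t↓) t↓ (λ _ → ≤-refl) (cellSNTm sn ⊢t t↓) ⊢t
  where
  -- f bounds the counts, so that it can stay fixed along cell steps.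
  go : ∀ {f t A} → Acc _≺_ f → Below N f → counts t ≼ f → CellSNTm Γ t →
       Γ ⊢Tm t ∶ A → SNTm Γ t
  go p@(acc p′) f↓ t≼f (acc c′) ⊢t = acc λ ((_ , ⊢u) , t⇝u) →
    -- A strict drop may create new coherences, but the counts still vanish from `N` on, so
    -- accessibility under cell steps is obtained afresh.
    [ (λ u≺t → let u≺f = ≺-≼-trans u≺t t≼f; u↓ = Below-≺ f↓ u≺f in
        go (p′ u≺f) u↓ (λ _ → ≤-refl) (cellSNTm sn ⊢u u↓) ⊢u)
    , (λ (c , u≼t) →
        go p f↓ (λ k → ≤-trans (u≼t k) (t≼f k)) (c′ ((_ , ⊢u) , c)) ⊢u)
    ]′ (⇝Tm-counts ⊢t t⇝u)

cellsSN : ∀ N → CellsSN N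
cellsSN (suc N) ⊢⋆ _ = acc λ { (_ , ()) }
cellsSN (suc N) (⊢⟶ ⊢A ⊢s ⊢t) A<N =
  -- The terms `s` and `t` have dimension below `N`, so the hypothesis at `N` covers the types of
  -- their coherences; the base stays at `suc N` but is structurally smaller.
  SNTy-⟶ (snTm ⊢s) (cellsSN (suc N) ⊢A (<⇒≤ A<N)) (snTm ⊢t)
  where
  snTm : ∀ {u} → _ ⊢Tm u ∶ _ → SNTm _ u
  snTm ⊢u = cells⇒SNTm (cellsSN N) (_ , ⊢u)
    λ k N≤k → count-vanishes ⊢u (<-≤-trans (s≤s⁻¹ A<N) N≤k)

strong-normalisation : ∀ {n} {Γ : Ctx n} {t} → WellFormed Γ t → SNTm Γ t
strong-normalisation (A , ⊢t) =
  cells⇒SNTm (cellsSN (suc (dim A))) (A , ⊢t) λ k → count-vanishes ⊢t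

corollary4p2p6 : ∀ {n} (Γ : Ctx n) →
    ¬ (Σ[ s ∈ (ℕ → WfTm Γ) ] (∀ i → s i ↝ s (suc i)))
corollary4p2p6 Γ (s , steps) = descend 0 (strong-normalisation (proj₂ (s 0)))
  where
  descend : ∀ i → ¬ SNTm Γ (proj₁ (s i))
  descend i (acc rs) = descend (suc i) (rs (proj₂ (s (suc i)) , steps i))
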